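{- Let $H$ be a realizable 3-uniform hypergraph and let $T$ be a realization of $H$. Then $H$ and $T$ share the same strong modules, i.e. a subset of $V(H)=V(T)$ is a strong module of $H$ if and only if it is a strong module of $T$.
   Context: All structures are finite. A 3-uniform hypergraph $H$ consists of a vertex set $V(H)$ and an edge set $E(H)\subseteq\binom{V(H)}{3}$. A tournament $T$ has a vertex set $V(T)$ and an arc set $A(T)$ such that for distinct $v,w\in V(T)$ exactly one of $vw,wv$ belongs to $A(T)$ (and there are no loops). A 3-cycle is a tournament on three vertices isomorphic to $(\{0,1,2\},\{01,12,20\})$. The $C_3$-structure $C_3(T)$ of a tournament $T$ is the 3-uniform hypergraph on $V(T)$ whose edges are the 3-element subsets $X$ of $V(T)$ such that $T[X]$ is a 3-cycle. A tournament $T$ with $V(T)=V(H)$ is a realization of $H$ if $H=C_3(T)$; $H$ is realizable if it admits a realization. A subset $M$ of $V(H)$ is a module of the hypergraph $H$ if for each $e\in E(H)$ such that $e\cap M\neq\emptyset$ and $e\setminus M\neq\emptyset$, there exists $m\in M$ such that $e\cap M=\{m\}$ and for every $n\in M$, $(e\setminus\{m\})\cup\{n\}\in E(H)$. A subset $M$ of $V(T)$ is a module of the tournament $T$ if for any $x,y\in M$ and $v\in V(T)$, if $xv,vy\in A(T)$, then $v\in M$. A module $M$ of $H$ (resp. $T$) is strong if for every module $N$ of $H$ (resp. $T$) with $M\cap N\neq\emptyset$, we have $M\subseteq N$ or $N\subseteq M$. -}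

module Defs where

open import Data.Fin.Base using (Fin)
open import Data.Fin.Patterns using (0F; 1F; 2F)
open import Data.Fin.Subset using (Subset; ⁅_⁆; _∈_; _⊆_; _∩_; _∪_; _─_; ∣_∣; Nonempty)
open import Data.Nat.Base using (ℕ)
open import Data.Product using (Σ; ∃; ∃-syntax; _×_; _,_; proj₁; proj₂)
open import Data.Sum using (_⊎_; inj₁; inj₂)
open import Data.Vec.Properties.WithK using ([]=-irrelevant)
open import Function.Bundles using (_⇔_; _↔_; module Inverse)
open import Level using (0ℓ)
open import Relation.Binary.Core using (Rel)
open import Relation.Binary.PropositionalEquality using (_≡_; _≢_; refl; cong)
open import Relation.Nullary using (¬_; contradiction)
open import Relation.Unary using (Pred)

record Hypergraph₃ (n : ℕ) : Set₁ where
  field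
    Edge   : Pred (Subset n) 0ℓ
    edge-3 : ∀ {e} → Edge e → ∣ e ∣ ≡ 3

-- The vertex type is arbitrary, so that a subtournament T[X] is again a
-- Tournament, on the subtype of elements of X.
record Tournament (V : Set) : Set₁ where
  field
    Arc        : Rel V 0ℓ
    loopless   : ∀ {v} → ¬ Arc v v
    exactlyOne : ∀ {v w} → v ≢ w →
                 (Arc v w × ¬ Arc w v) ⊎ (Arc w v × ¬ Arc v w)

record _≅_ {V W : Set} (S : Tournament V) (T : Tournament W) : Set where
  private
    module S = Tournament S
    module T = Tournament T
  field
    bijection : V ↔ W
  open Inverse bijection using (to)
  field
    arc⇔arc : ∀ v w → S.Arc v w ⇔ T.Arc (to v) (to w)

induced : ∀ {n} → Tournament (Fin n) → (X : Subset n) → Tournament (∃ (_∈ X))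
induced T X = record
  { Arc        = λ v w → Arc (proj₁ v) (proj₁ w)
  ; loopless   = loopless
  ; exactlyOne = λ v≢w → exactlyOne (λ v≡w → v≢w (∈-ext v≡w))
  }
  where
  open Tournament T
  ∈-ext : {v w : ∃ (_∈ X)} → proj₁ v ≡ proj₁ w → v ≡ w
  ∈-ext {v , p} {.v , q} refl = cong (v ,_) ([]=-irrelevant p q)

data CycleArc : Rel (Fin 3) 0ℓ where
  0→1 : CycleArc 0F 1F
  1→2 : CycleArc 1F 2F
  2→0 : CycleArc 2F 0F

cycle : Tournament (Fin 3)
cycle = record { Arc = CycleArc ; loopless = λ () ; exactlyOne = one _ _ }
  where
  one : ∀ v w → v ≢ w →
        (CycleArc v w × ¬ CycleArc w v) ⊎ (CycleArc w v × ¬ CycleArc v w)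
  one 0F 0F v≢w = contradiction refl v≢w
  one 0F 1F _   = inj₁ (0→1 , λ ())
  one 0F 2F _   = inj₂ (2→0 , λ ())
  one 1F 0F _   = inj₂ (0→1 , λ ())
  one 1F 1F v≢w = contradiction refl v≢w
  one 1F 2F _   = inj₁ (1→2 , λ ())
  one 2F 0F _   = inj₁ (2→0 , λ ())
  one 2F 1F _   = inj₂ (1→2 , λ ())
  one 2F 2F v≢w = contradiction refl v≢w

Is3Cycle : ∀ {V} → Tournament V → Set
Is3Cycle T = T ≅ cycle

C₃ : ∀ {n} → Tournament (Fin n) → Hypergraph₃ n
C₃ T = record
  { Edge   = λ X → ∣ X ∣ ≡ 3 × Is3Cycle (induced T X)
  ; edge-3 = proj₁
  }

-- Equality of hypergraphs on the same vertex set: equality of edge sets.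
_≐_ : ∀ {n} → Hypergraph₃ n → Hypergraph₃ n → Set
H ≐ K = ∀ e → Hypergraph₃.Edge H e ⇔ Hypergraph₃.Edge K e

_Realizes_ : ∀ {n} → Tournament (Fin n) → Hypergraph₃ n → Set
T Realizes H = H ≐ C₃ T

Realizable : ∀ {n} → Hypergraph₃ n → Set₁
Realizable {n} H = Σ (Tournament (Fin n)) (_Realizes H)

HypergraphModule : ∀ {n} → Hypergraph₃ n → Pred (Subset n) 0ℓ
HypergraphModule H M =
  ∀ e → Edge e → Nonempty (e ∩ M) → Nonempty (e ─ M) →
  ∃[ m ] (m ∈ M × e ∩ M ≡ ⁅ m ⁆ ×
          (∀ n → n ∈ M → Edge ((e ─ ⁅ m ⁆) ∪ ⁅ n ⁆)))
  where open Hypergraph₃ H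

TournamentModule : ∀ {n} → Tournament (Fin n) → Pred (Subset n) 0ℓ
TournamentModule T M =
  ∀ x y v → x ∈ M → y ∈ M → Arc x v → Arc v y → v ∈ M
  where open Tournament T

Strong : ∀ {n} → Pred (Subset n) 0ℓ → Pred (Subset n) 0ℓ
Strong IsModule M =
  IsModule M ×
  (∀ N → IsModule N → Nonempty (M ∩ N) → M ⊆ N ⊎ N ⊆ M)

{-# OPTIONS --safe #-}

-- Tournament modules of T are hypergraph modules of C₃(T). For a hypergraph
-- module N and a vertex v ∉ N with in-neighbours and out-neighbours in N, let
-- low(v) consist of the in-neighbours of v in N together with the vertices
-- outside N whose set of in-neighbours in N is nonempty and contained in that
-- of v. It is a tournament module containing v and missing the out-neighbours
-- of v in N, so it overlaps N; hence a strong hypergraph module has no such v.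
-- Conversely, a strong tournament module M meeting N and containing v ∉ N is
-- comparable with low(v), with its dual under arc reversal, and with the union
-- of N and all such splitting vertices; these comparisons give N ⊆ M.

module Submission where

open import Defs
open import Data.Fin.Base using (Fin)
open import Data.Fin.Patterns using (0F; 1F; 2F)
open import Data.Fin.Properties using (_≟_; any?; all?)
open import Data.Fin.Subset
  using (Subset; inside; outside; ⁅_⁆; _∈_; _∉_; _⊆_; _∩_; _∪_; _─_; ∣_∣; Nonempty)
open import Data.Fin.Subset.Properties
  using (_∈?_; ⊆-antisym; x∈⁅x⁆; x∈⁅y⁆⇒x≡y; x∈p∩q⁺; x∈p∩q⁻; x∈p∪q⁺; x∈p∪q⁻;
         x∈p∧x∉q⇒x∈p─q; p─q⊆p; ∪-identityˡ; ∪-comm; ∪-assoc; ∣⁅x⁆∣≡1)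
open import Data.Nat.Base using (ℕ; suc)
open import Data.Product using (∃; ∃-syntax; _×_; _,_; proj₁; proj₂)
open import Data.Sum using (_⊎_; inj₁; inj₂; [_,_]′)
open import Data.Vec.Base using (_∷_; here; there; tabulate)
open import Data.Vec.Properties using (lookup∘tabulate; []=⇒lookup; lookup⇒[]=)
open import Data.Vec.Properties.WithK using ([]=-irrelevant)
open import Function.Base using (_∘_; flip)
open import Function.Bundles using (_⇔_; mk⇔; mk↔ₛ′; module Equivalence; module Inverse)
open import Function.Construct.Symmetry using (⇔-sym)
open import Level using (0ℓ)
open import Relation.Binary.PropositionalEquality
  using (_≡_; _≢_; refl; sym; trans; cong; subst; subst₂)
open import Relation.Nullary using (¬_; Dec; does; yes; no; contradiction)
open import Relation.Nullary.Decidable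
  using (dec-true; _×-dec_; _⊎-dec_; _→-dec_; ¬?)
open import Relation.Unary using (Pred; Decidable)

private
  variable
    n : ℕ

-- Subsets of a finite set and vertex triples.

⟦_⟧ : {P : Pred (Fin n) 0ℓ} → Decidable P → Subset n
⟦ P? ⟧ = tabulate (does ∘ P?)

module _ {P : Pred (Fin n) 0ℓ} (P? : Decidable P) {x : Fin n} where

  ∈⟦⟧⁺ : P x → x ∈ ⟦ P? ⟧
  ∈⟦⟧⁺ px = lookup⇒[]= x _ (trans (lookup∘tabulate _ x) (dec-true (P? x) px))

  ∈⟦⟧⁻ : x ∈ ⟦ P? ⟧ → P x
  ∈⟦⟧⁻ x∈ with P? x | trans (sym (lookup∘tabulate (does ∘ P?) x)) ([]=⇒lookup x∈)
  ... | yes px | _ = px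

x∈p─q⇒x∉q : ∀ (p q : Subset n) {x} → x ∈ p ─ q → x ∉ q
x∈p─q⇒x∉q (_ ∷ p) (_ ∷ q) (there x∈) (there x∈q) = x∈p─q⇒x∉q p q x∈ x∈q

x∉p⇒∣⁅x⁆∪p∣≡1+∣p∣ : ∀ (x : Fin n) (p : Subset n) → x ∉ p → ∣ ⁅ x ⁆ ∪ p ∣ ≡ suc ∣ p ∣
x∉p⇒∣⁅x⁆∪p∣≡1+∣p∣ Fin.zero    (inside  ∷ p) x∉p = contradiction here x∉p
x∉p⇒∣⁅x⁆∪p∣≡1+∣p∣ Fin.zero    (outside ∷ p) x∉p = cong (suc ∘ ∣_∣) (∪-identityˡ p)
x∉p⇒∣⁅x⁆∪p∣≡1+∣p∣ (Fin.suc x) (inside  ∷ p) x∉p =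
  cong suc (x∉p⇒∣⁅x⁆∪p∣≡1+∣p∣ x p (x∉p ∘ there))
x∉p⇒∣⁅x⁆∪p∣≡1+∣p∣ (Fin.suc x) (outside ∷ p) x∉p =
  x∉p⇒∣⁅x⁆∪p∣≡1+∣p∣ x p (x∉p ∘ there)

triple : Fin n → Fin n → Fin n → Subset n
triple a b c = ⁅ a ⁆ ∪ (⁅ b ⁆ ∪ ⁅ c ⁆)

triple-rotate : ∀ (a b c : Fin n) → triple a b c ≡ triple b c a
triple-rotate a b c =
  trans (∪-comm ⁅ a ⁆ (⁅ b ⁆ ∪ ⁅ c ⁆)) (∪-assoc ⁅ b ⁆ ⁅ c ⁆ ⁅ a ⁆)

-- Positions are the vertices of `cycle`, so membership in a triple and an isomorphism with `cycle`
-- share one index.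
corner : Fin n → Fin n → Fin n → Fin 3 → Fin n
corner a b c 0F = a
corner a b c 1F = b
corner a b c 2F = c

module _ (a b c : Fin n) where

  ∈-triple⁻ : ∀ {u} → u ∈ triple a b c → ∃[ i ] corner a b c i ≡ u
  ∈-triple⁻ u∈ with x∈p∪q⁻ ⁅ a ⁆ _ u∈
  ... | inj₁ u∈a = 0F , sym (x∈⁅y⁆⇒x≡y a u∈a)
  ... | inj₂ u∈bc with x∈p∪q⁻ ⁅ b ⁆ _ u∈bc
  ...   | inj₁ u∈b = 1F , sym (x∈⁅y⁆⇒x≡y b u∈b)
  ...   | inj₂ u∈c = 2F , sym (x∈⁅y⁆⇒x≡y c u∈c)

  corner∈triple : ∀ i → corner a b c i ∈ triple a b c
  corner∈triple 0F = x∈p∪q⁺ (inj₁ (x∈⁅x⁆ a))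
  corner∈triple 1F = x∈p∪q⁺ (inj₂ (x∈p∪q⁺ (inj₁ (x∈⁅x⁆ b))))
  corner∈triple 2F = x∈p∪q⁺ (inj₂ (x∈p∪q⁺ (inj₂ (x∈⁅x⁆ c))))

-- Orientation of 3-cycles and arc reversal.

cycle-closes : ∀ {i j k} → CycleArc i j → k ≢ i → k ≢ j → CycleArc j k × CycleArc k i
cycle-closes {k = 0F} 0→1 k≢i k≢j = contradiction refl k≢i
cycle-closes {k = 1F} 0→1 k≢i k≢j = contradiction refl k≢j
cycle-closes {k = 2F} 0→1 k≢i k≢j = 1→2 , 2→0
cycle-closes {k = 0F} 1→2 k≢i k≢j = 2→0 , 0→1
cycle-closes {k = 1F} 1→2 k≢i k≢j = contradiction refl k≢i
cycle-closes {k = 2F} 1→2 k≢i k≢j = contradiction refl k≢j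
cycle-closes {k = 0F} 2→0 k≢i k≢j = contradiction refl k≢j
cycle-closes {k = 1F} 2→0 k≢i k≢j = 0→1 , 1→2
cycle-closes {k = 2F} 2→0 k≢i k≢j = contradiction refl k≢i

∈∉⇒≢ : ∀ {p : Subset n} {x y} → x ∈ p → y ∉ p → x ≢ y
∈∉⇒≢ x∈p y∉p refl = y∉p x∈p

reverse : ∀ {V} → Tournament V → Tournament V
reverse T = record
  { Arc        = flip Arc
  ; loopless   = loopless
  ; exactlyOne = λ v≢w → exactlyOne (v≢w ∘ sym)
  }
  where open Tournament T

reverse-module : ∀ (T : Tournament (Fin n)) {M} →
                 TournamentModule (reverse T) M → TournamentModule T M
reverse-module T mod x y v x∈ y∈ x→v v→y = mod y x v y∈ x∈ v→y x→v

-- Edges of `C₃ T` as cyclically oriented triples.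

module Cycles (T : Tournament (Fin n)) where
  open Tournament T public

  asym : ∀ {v w} → Arc v w → ¬ Arc w v
  asym {v} {w} v→w w→v with v ≟ w
  ... | yes refl = loopless v→w
  ... | no v≢w with exactlyOne v≢w
  ...   | inj₁ (_ , w↛v) = w↛v w→v
  ...   | inj₂ (_ , v↛w) = v↛w v→w

  arc⇒≢ : ∀ {v w} → Arc v w → v ≢ w
  arc⇒≢ v→w refl = loopless v→w

  total : ∀ {v w} → v ≢ w → Arc v w ⊎ Arc w v
  total v≢w = [ inj₁ ∘ proj₁ , inj₂ ∘ proj₁ ]′ (exactlyOne v≢w)

  arc? : ∀ v w → Dec (Arc v w)
  arc? v w with v ≟ w
  ... | yes refl = no loopless
  ... | no v≢w with exactlyOne v≢w
  ...   | inj₁ (v→w , _) = yes v→w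
  ...   | inj₂ (_ , v↛w) = no v↛w

  Cyclic : Fin n → Fin n → Fin n → Set
  Cyclic a b c = Arc a b × Arc b c × Arc c a

  Edge : Pred (Subset n) 0ℓ
  Edge = Hypergraph₃.Edge (C₃ T)

  edge⇒cyclic : ∀ {e} → Edge e →
                ∃[ a ] ∃[ b ] ∃[ c ] Cyclic a b c × e ≡ triple a b c
  edge⇒cyclic {e} (_ , φ) =
    vertex 0F , vertex 1F , vertex 2F ,
    (arc 0→1 , arc 1→2 , arc 2→0) , ⊆-antisym e⊆ ⊆e
    where
    open _≅_ φ
    open Inverse bijection

    vertex : Fin 3 → Fin n
    vertex i = proj₁ (from i)

    arc : ∀ {i j} → CycleArc i j → Arc (vertex i) (vertex j)
    arc {i} {j} i→j = Equivalence.from (arc⇔arc (from i) (from j))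
      (subst₂ CycleArc (sym (strictlyInverseˡ i)) (sym (strictlyInverseˡ j)) i→j)

    vertices : Fin 3 → Fin n
    vertices = corner (vertex 0F) (vertex 1F) (vertex 2F)

    -- `corner` reduces only at literal positions, hence the case split.
    vertices≗vertex : ∀ i → vertices i ≡ vertex i
    vertices≗vertex 0F = refl
    vertices≗vertex 1F = refl
    vertices≗vertex 2F = refl

    e⊆ : e ⊆ triple (vertex 0F) (vertex 1F) (vertex 2F)
    e⊆ {u} u∈e = subst (_∈ triple (vertex 0F) (vertex 1F) (vertex 2F))
      (trans (vertices≗vertex (to (u , u∈e)))
             (cong proj₁ (strictlyInverseʳ (u , u∈e))))
      (corner∈triple _ _ _ (to (u , u∈e)))

    ⊆e : triple (vertex 0F) (vertex 1F) (vertex 2F) ⊆ e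
    ⊆e u∈ with i , refl ← ∈-triple⁻ (vertex 0F) (vertex 1F) (vertex 2F) u∈ =
      subst (_∈ e) (sym (vertices≗vertex i)) (proj₂ (from i))

  cyclic⇒edge : ∀ {a b c} → Cyclic a b c → Edge (triple a b c)
  cyclic⇒edge {a} {b} {c} (a→b , b→c , c→a) = card , record
    { bijection = mk↔ₛ′ (λ u → index (proj₂ u)) (λ i → v i , corner∈triple a b c i)
        (λ i → v-injective (v-index (corner∈triple a b c i)))
        (λ u → ∈-ext (v-index (proj₂ u)))
    ; arc⇔arc = λ x y → mk⇔
        (arc⇒cycleArc ∘ subst₂ Arc (sym (v-index (proj₂ x))) (sym (v-index (proj₂ y))))
        (subst₂ Arc (v-index (proj₂ x)) (v-index (proj₂ y)) ∘ cycleArc⇒arc)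
    }
    where
    v : Fin 3 → Fin n
    v = corner a b c

    index : ∀ {u} → u ∈ triple a b c → Fin 3
    index u∈ = proj₁ (∈-triple⁻ a b c u∈)

    v-index : ∀ {u} (u∈ : u ∈ triple a b c) → v (index u∈) ≡ u
    v-index u∈ = proj₂ (∈-triple⁻ a b c u∈)

    ∈-ext : {x y : ∃ (_∈ triple a b c)} → proj₁ x ≡ proj₁ y → x ≡ y
    ∈-ext {x , p} {.x , q} refl = cong (x ,_) ([]=-irrelevant p q)

    cycleArc⇒arc : ∀ {i j} → CycleArc i j → Arc (v i) (v j)
    cycleArc⇒arc 0→1 = a→b
    cycleArc⇒arc 1→2 = b→c
    cycleArc⇒arc 2→0 = c→a

    -- Preserving arcs suffices: distinct positions are joined by some arc of `cycle`, and the wrong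
    -- direction would reverse an arc of `T`.
    arc⇒cycleArc : ∀ {i j} → Arc (v i) (v j) → CycleArc i j
    arc⇒cycleArc {i} {j} i→j with i ≟ j
    ... | yes refl = contradiction i→j loopless
    ... | no i≢j with Tournament.exactlyOne cycle i≢j
    ...   | inj₁ (arc , _) = arc
    ...   | inj₂ (arc , _) = contradiction (cycleArc⇒arc arc) (asym i→j)

    v-injective : ∀ {i j} → v i ≡ v j → i ≡ j
    v-injective {i} {j} vi≡vj with i ≟ j
    ... | yes i≡j = i≡j
    ... | no i≢j with Tournament.exactlyOne cycle i≢j
    ...   | inj₁ (arc , _) = contradiction vi≡vj (arc⇒≢ (cycleArc⇒arc arc))
    ...   | inj₂ (arc , _) = contradiction (sym vi≡vj) (arc⇒≢ (cycleArc⇒arc arc))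

    a∉bc : a ∉ ⁅ b ⁆ ∪ ⁅ c ⁆
    a∉bc a∈ = [ arc⇒≢ a→b ∘ x∈⁅y⁆⇒x≡y b , arc⇒≢ c→a ∘ sym ∘ x∈⁅y⁆⇒x≡y c ]′
                (x∈p∪q⁻ ⁅ b ⁆ ⁅ c ⁆ a∈)

    card : ∣ triple a b c ∣ ≡ 3
    card = trans (x∉p⇒∣⁅x⁆∪p∣≡1+∣p∣ a _ a∉bc) (cong suc
      (trans (x∉p⇒∣⁅x⁆∪p∣≡1+∣p∣ b _ (arc⇒≢ b→c ∘ x∈⁅y⁆⇒x≡y c))
             (cong suc (∣⁅x⁆∣≡1 c))))

  -- An edge is a bare set, but one arc of a 3-cycle forces the other two; this recovers the
  -- orientation from a single known arc.
  edge-closes : ∀ {e} → Edge e → ∀ {u v w} → u ∈ e → v ∈ e → w ∈ e →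
                u ≢ v → u ≢ w → Arc v w → Cyclic u v w
  edge-closes {e} (_ , φ) {u} {v} {w} u∈e v∈e w∈e u≢v u≢w v→w =
    Equivalence.from (arc⇔arc u′ v′) (proj₂ closes) , v→w ,
    Equivalence.from (arc⇔arc w′ u′) (proj₁ closes)
    where
    open _≅_ φ
    open Inverse bijection

    u′ v′ w′ : ∃ (_∈ e)
    u′ = u , u∈e
    v′ = v , v∈e
    w′ = w , w∈e

    to-injective : ∀ {x y} → to x ≡ to y → x ≡ y
    to-injective {x} {y} eq =
      trans (sym (strictlyInverseʳ x)) (trans (cong from eq) (strictlyInverseʳ y))

    closes : CycleArc (to w′) (to u′) × CycleArc (to u′) (to v′)
    closes = cycle-closes (Equivalence.to (arc⇔arc v′ w′) v→w)
      (u≢v ∘ cong proj₁ ∘ to-injective) (u≢w ∘ cong proj₁ ∘ to-injective)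

  -- From tournament modules to hypergraph modules.

  module _ {M : Subset n} (mod : TournamentModule T M) where

    private
      Exchange : Subset n → Set
      Exchange e = ∃[ m ] (m ∈ M × e ∩ M ≡ ⁅ m ⁆ ×
                           (∀ x → x ∈ M → Edge ((e ─ ⁅ m ⁆) ∪ ⁅ x ⁆)))

      -- Every vertex of `M` sees `b` and `c` as `a` does, since otherwise `b` or `c` would lie
      -- between two members of `M`. So `a` can be replaced in the cycle.
      exchange : ∀ {a b c} → a ∈ M → b ∉ M → c ∉ M → Cyclic a b c →
                 Exchange (triple a b c)
      exchange {a} {b} {c} a∈M b∉M c∉M (a→b , b→c , c→a) =
        a , a∈M , ⊆-antisym ∩⊆ ⊆∩ ,
        λ x x∈M → subst Edge (sym (⊆-antisym (⊆triple x) (triple⊆ x)))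
                        (cyclic⇒edge (x→b x x∈M , b→c , c→x x x∈M))
        where
        e = triple a b c

        ∩⊆ : e ∩ M ⊆ ⁅ a ⁆
        ∩⊆ u∈ with u∈e , u∈M ← x∈p∩q⁻ e M u∈ with ∈-triple⁻ a b c u∈e
        ... | 0F , refl = x∈⁅x⁆ a
        ... | 1F , refl = contradiction u∈M b∉M
        ... | 2F , refl = contradiction u∈M c∉M

        ⊆∩ : ⁅ a ⁆ ⊆ e ∩ M
        ⊆∩ u∈ with refl ← x∈⁅y⁆⇒x≡y a u∈ = x∈p∩q⁺ (corner∈triple a b c 0F , a∈M)

        ⊆triple : ∀ x → (e ─ ⁅ a ⁆) ∪ ⁅ x ⁆ ⊆ triple x b c
        ⊆triple x u∈ with x∈p∪q⁻ (e ─ ⁅ a ⁆) ⁅ x ⁆ u∈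
        ... | inj₂ u∈x with refl ← x∈⁅y⁆⇒x≡y x u∈x = corner∈triple x b c 0F
        ... | inj₁ u∈─ with ∈-triple⁻ a b c (p─q⊆p e ⁅ a ⁆ u∈─)
        ...   | 0F , refl = contradiction (x∈⁅x⁆ a) (x∈p─q⇒x∉q e ⁅ a ⁆ u∈─)
        ...   | 1F , refl = corner∈triple x b c 1F
        ...   | 2F , refl = corner∈triple x b c 2F

        triple⊆ : ∀ x → triple x b c ⊆ (e ─ ⁅ a ⁆) ∪ ⁅ x ⁆
        triple⊆ x u∈ with ∈-triple⁻ x b c u∈
        ... | 0F , refl = x∈p∪q⁺ (inj₂ (x∈⁅x⁆ x))
        ... | 1F , refl = x∈p∪q⁺ (inj₁ (x∈p∧x∉q⇒x∈p─q (corner∈triple a b c 1F)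
                            (arc⇒≢ a→b ∘ sym ∘ x∈⁅y⁆⇒x≡y a)))
        ... | 2F , refl = x∈p∪q⁺ (inj₁ (x∈p∧x∉q⇒x∈p─q (corner∈triple a b c 2F)
                            (arc⇒≢ c→a ∘ x∈⁅y⁆⇒x≡y a)))

        x→b : ∀ x → x ∈ M → Arc x b
        x→b x x∈M with total (∈∉⇒≢ x∈M b∉M)
        ... | inj₁ x→b = x→b
        ... | inj₂ b→x = contradiction (mod a x b a∈M x∈M a→b b→x) b∉M

        c→x : ∀ x → x ∈ M → Arc c x
        c→x x x∈M with total (∈∉⇒≢ x∈M c∉M)
        ... | inj₁ x→c = contradiction (mod x a c x∈M a∈M x→c c→a) c∉M
        ... | inj₂ c→x = c→x

    -- Count the corners in `M`. One corner is `exchange` up to rotation; with two, the third lies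
    -- between them on the cycle and is forced into `M`; three contradict `q`, none contradicts `p`.
    tournamentModule⇒hypergraphModule : HypergraphModule (C₃ T) M
    tournamentModule⇒hypergraphModule e edge (p , p∈) (q , q∈)
      with a , b , c , (a→b , b→c , c→a) , refl ← edge⇒cyclic edge
      with a ∈? M | b ∈? M | c ∈? M
    ... | yes a∈ | no b∉  | no c∉  = exchange a∈ b∉ c∉ (a→b , b→c , c→a)
    ... | no a∉  | yes b∈ | no c∉  =
      subst Exchange (sym (triple-rotate a b c)) (exchange b∈ c∉ a∉ (b→c , c→a , a→b))
    ... | no a∉  | no b∉  | yes c∈ =
      subst Exchange (triple-rotate c a b) (exchange c∈ a∉ b∉ (c→a , a→b , b→c))
    ... | yes a∈ | yes b∈ | no c∉  = contradiction (mod b a c b∈ a∈ b→c c→a) c∉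
    ... | yes a∈ | no b∉  | yes c∈ = contradiction (mod a c b a∈ c∈ a→b b→c) b∉
    ... | no a∉  | yes b∈ | yes c∈ = contradiction (mod c b a c∈ b∈ c→a a→b) a∉
    ... | yes a∈ | yes b∈ | yes c∈
      with ∈-triple⁻ a b c (p─q⊆p e M q∈)
    ...   | 0F , refl = contradiction a∈ (x∈p─q⇒x∉q e M q∈)
    ...   | 1F , refl = contradiction b∈ (x∈p─q⇒x∉q e M q∈)
    ...   | 2F , refl = contradiction c∈ (x∈p─q⇒x∉q e M q∈)
    tournamentModule⇒hypergraphModule e edge (p , p∈) (q , q∈)
      | no a∉  | no b∉  | no c∉
      with p∈e , p∈M ← x∈p∩q⁻ e M p∈ with ∈-triple⁻ a b c p∈e
    ...   | 0F , refl = contradiction p∈M a∉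
    ...   | 1F , refl = contradiction p∈M b∉
    ...   | 2F , refl = contradiction p∈M c∉

-- Hypergraph modules in terms of 3-cycles.

-- What hypergraph modules of C₃(T) retain of the 3-cycles of T; unlike C₃(T)
-- itself, this form is manifestly invariant under arc reversal.
record CycleModule (T : Tournament (Fin n)) (N : Subset n) : Set where
  open Cycles T using (Cyclic)
  field
    closed  : ∀ {x y v} → x ∈ N → y ∈ N → Cyclic x y v → v ∈ N
    uniform : ∀ {x y v w} → x ∈ N → y ∈ N → v ∉ N → w ∉ N →
              Cyclic x v w → Cyclic y v w

reverse-cycleModule : ∀ {T : Tournament (Fin n)} {N} →
                      CycleModule T N → CycleModule (reverse T) N
reverse-cycleModule cm = record
  { closed  = λ x∈ y∈ (y→x , v→y , x→v) → closed y∈ x∈ (y→x , x→v , v→y)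
  -- A reversed cycle visits `w` before `v`, so the two swap roles.
  ; uniform = λ x∈ y∈ v∉ w∉ (v→x , w→v , x→w) →
      let y→w , _ , v→y = uniform x∈ y∈ w∉ v∉ (x→w , w→v , v→x) in v→y , w→v , y→w
  }
  where open CycleModule cm

hypergraphModule⇒cycleModule : ∀ {T : Tournament (Fin n)} {N} →
                               HypergraphModule (C₃ T) N → CycleModule T N
hypergraphModule⇒cycleModule {T = T} {N} mod = record { closed = closed ; uniform = uniform }
  where
  open Cycles T

  closed : ∀ {x y v} → x ∈ N → y ∈ N → Cyclic x y v → v ∈ N
  closed {x} {y} {v} x∈ y∈ cyc@(x→y , _) with v ∈? N
  ... | yes v∈ = v∈
  ... | no v∉
    with m , _ , e∩N≡m , _ ← mod (triple x y v) (cyclic⇒edge cyc)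
           (x , x∈p∩q⁺ (corner∈triple x y v 0F , x∈))
           (v , x∈p∧x∉q⇒x∈p─q (corner∈triple x y v 2F) v∉) =
    -- The edge leaves `N` at `v`, so it meets `N` in one vertex, yet it contains both `x` and `y`.
    contradiction (trans (≡m 0F x∈) (sym (≡m 1F y∈))) (arc⇒≢ x→y)
    where
    ≡m : ∀ i → corner x y v i ∈ N → corner x y v i ≡ m
    ≡m i i∈ = x∈⁅y⁆⇒x≡y m
      (subst (_ ∈_) e∩N≡m (x∈p∩q⁺ (corner∈triple x y v i , i∈)))

  uniform : ∀ {x y v w} → x ∈ N → y ∈ N → v ∉ N → w ∉ N → Cyclic x v w → Cyclic y v w
  uniform {x} {y} {v} {w} x∈ y∈ v∉ w∉ cyc@(_ , v→w , _)
    with m , m∈ , _ , exchange ← mod (triple x v w) (cyclic⇒edge cyc)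
           (x , x∈p∩q⁺ (corner∈triple x v w 0F , x∈))
           (v , x∈p∧x∉q⇒x∈p─q (corner∈triple x v w 1F) v∉) =
    -- The exchanged edge contains `y`, `v` and `w`, because `m` lies in `N` and so differs from `v`
    -- and `w`. The old arc from `v` to `w` orients it.
    edge-closes (exchange y y∈) (x∈p∪q⁺ (inj₂ (x∈⁅x⁆ y))) (stays 1F v∉) (stays 2F w∉)
      (∈∉⇒≢ y∈ v∉) (∈∉⇒≢ y∈ w∉) v→w
    where
    stays : ∀ i → corner x v w i ∉ N → corner x v w i ∈ (triple x v w ─ ⁅ m ⁆) ∪ ⁅ y ⁆
    stays i i∉ = x∈p∪q⁺ (inj₁ (x∈p∧x∉q⇒x∈p─q (corner∈triple x v w i)
      (∈∉⇒≢ m∈ i∉ ∘ sym ∘ x∈⁅y⁆⇒x≡y m)))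

-- Tournament modules built from vertices that split `N`.

module Splitting (T : Tournament (Fin n)) {N : Subset n} (cm : CycleModule T N) where
  open Cycles T
  open CycleModule cm

  -- Outside `N`, requiring an in-neighbour in `N` excludes the vertices that dominate all of `N`.
  Low : Fin n → Pred (Fin n) 0ℓ
  Low v u = (u ∈ N × Arc u v) ⊎
            (u ∉ N × (∃[ x ] (x ∈ N × Arc x u)) × (∀ x → x ∈ N → Arc x u → Arc x v))

  low? : ∀ v → Decidable (Low v)
  low? v u = ((u ∈? N) ×-dec arc? u v) ⊎-dec
             (¬? (u ∈? N) ×-dec any? (λ x → (x ∈? N) ×-dec arc? x u) ×-dec
              all? (λ x → (x ∈? N) →-dec (arc? x u →-dec arc? x v)))

  low : Fin n → Subset n
  low v = ⟦ low? v ⟧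

  in-neighbour∈low : ∀ {u v} → u ∈ N → Arc u v → u ∈ low v
  in-neighbour∈low {v = v} u∈ u→v = ∈⟦⟧⁺ (low? v) (inj₁ (u∈ , u→v))

  out-neighbour∉low : ∀ {u v} → u ∈ N → Arc v u → u ∉ low v
  out-neighbour∉low {v = v} u∈ v→u u∈low with ∈⟦⟧⁻ (low? v) u∈low
  ... | inj₁ (_ , u→v) = asym v→u u→v
  ... | inj₂ (u∉ , _)  = u∉ u∈

  v∈low : ∀ {a v} → a ∈ N → v ∉ N → Arc a v → v ∈ low v
  v∈low {a} {v} a∈ v∉ a→v = ∈⟦⟧⁺ (low? v) (inj₂ (v∉ , (a , a∈ , a→v) , λ _ _ x→v → x→v))

  -- Let `u` lie between `x` and `y`. If `u` is in `N`, the arc to `y` yields an arc to `v`. If not,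
  -- `x` provides an in-neighbour of `u` in `N` and `y` bounds its in-neighbours by those of `v`.
  -- Any failure closes a 3-cycle that `closed` or `uniform` rules out.
  low-module : ∀ {v b} → v ∉ N → b ∈ N → Arc v b → TournamentModule T (low v)
  low-module {v} {b} v∉ b∈ v→b x y u x∈ y∈ x→u u→y =
    ∈⟦⟧⁺ (low? v) (between (∈⟦⟧⁻ (low? v) x∈) (∈⟦⟧⁻ (low? v) y∈))
    where
    between : Low v x → Low v y → Low v u
    between lx ly with u ∈? N
    between lx (inj₁ (y∈ , y→v)) | yes u∈ with total (∈∉⇒≢ u∈ v∉)
    ... | inj₁ u→v = inj₁ (u∈ , u→v)
    ... | inj₂ v→u = contradiction (closed u∈ y∈ (u→y , y→v , v→u)) v∉
    between lx (inj₂ (_ , _ , y⊑v)) | yes u∈ = inj₁ (u∈ , y⊑v u u∈ u→y)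
    between lx ly | no u∉ = inj₂ (u∉ , nonempty lx , u⊑v ly)
      where
      nonempty : Low v x → ∃[ z ] (z ∈ N × Arc z u)
      nonempty (inj₁ (x∈ , _)) = x , x∈ , x→u
      nonempty (inj₂ (x∉ , (a , a∈ , a→x) , x⊑v)) with total (∈∉⇒≢ a∈ u∉)
      ... | inj₁ a→u = a , a∈ , a→u
      -- Moving the cycle on `a`, `x`, `u` from `a` to `b` makes `b` an in-neighbour of `x`, hence
      -- of `v`.
      ... | inj₂ u→a with b→x , _ ← uniform a∈ b∈ x∉ u∉ (a→x , x→u , u→a) =
        contradiction (x⊑v b b∈ b→x) (asym v→b)

      u⊑v : Low v y → ∀ z → z ∈ N → Arc z u → Arc z v
      u⊑v ly z z∈ z→u with total (∈∉⇒≢ z∈ v∉)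
      u⊑v ly z z∈ z→u | inj₁ z→v = z→v
      u⊑v (inj₁ (y∈ , y→v)) z z∈ z→u | inj₂ v→z with total {y} {z} (λ { refl → asym v→z y→v })
      ... | inj₁ y→z = contradiction (closed y∈ z∈ (y→z , z→u , u→y)) u∉
      ... | inj₂ z→y = contradiction (closed z∈ y∈ (z→y , y→v , v→z)) v∉
      u⊑v (inj₂ (y∉ , (a , a∈ , a→y) , y⊑v)) z z∈ z→u | inj₂ v→z with total (∈∉⇒≢ z∈ y∉)
      ... | inj₁ z→y = y⊑v z z∈ z→y
      -- Moving the cycle on `z`, `u`, `y` from `z` to `a` would reverse the arc from `a` to `y`.
      ... | inj₂ y→z with _ , _ , y→a ← uniform z∈ a∈ u∉ y∉ (z→u , u→y , y→z) =
        contradiction y→a (asym a→y)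

  Splits : Pred (Fin n) 0ℓ
  Splits u = (∃[ x ] (x ∈ N × Arc x u)) × (∃[ y ] (y ∈ N × Arc u y))

  splits? : Decidable Splits
  splits? u = any? (λ x → (x ∈? N) ×-dec arc? x u) ×-dec
              any? (λ y → (y ∈? N) ×-dec arc? u y)

  hull? : Decidable (λ u → u ∈ N ⊎ (u ∉ N × Splits u))
  hull? u = (u ∈? N) ⊎-dec (¬? (u ∈? N) ×-dec splits? u)

  -- The tournament module generated by `N`: any tournament module containing `N` must contain the
  -- vertices that split it.
  hull : Subset n
  hull = ⟦ hull? ⟧

  -- A vertex outside `N` between two members gets an in-neighbour in `N` from the lower one and an
  -- out-neighbour from the upper one. Otherwise `uniform` would give a splitting vertex the same
  -- arc direction to both of its witnesses `a` and `b`.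
  hull-module : TournamentModule T hull
  hull-module x y u x∈ y∈ x→u u→y = ∈⟦⟧⁺ hull? between
    where
    between : u ∈ N ⊎ (u ∉ N × Splits u)
    between with u ∈? N
    ... | yes u∈ = inj₁ u∈
    ... | no u∉  = inj₂ (u∉ , below (∈⟦⟧⁻ hull? x∈) , above (∈⟦⟧⁻ hull? y∈))
      where
      below : x ∈ N ⊎ (x ∉ N × Splits x) → ∃[ z ] (z ∈ N × Arc z u)
      below (inj₁ x∈) = x , x∈ , x→u
      below (inj₂ (x∉ , (a , a∈ , a→x) , (b , b∈ , x→b))) with total (∈∉⇒≢ a∈ u∉)
      ... | inj₁ a→u = a , a∈ , a→u
      ... | inj₂ u→a with b→x , _ ← uniform a∈ b∈ x∉ u∉ (a→x , x→u , u→a) =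
        contradiction b→x (asym x→b)

      above : y ∈ N ⊎ (y ∉ N × Splits y) → ∃[ z ] (z ∈ N × Arc u z)
      above (inj₁ y∈) = y , y∈ , u→y
      above (inj₂ (y∉ , (a , a∈ , a→y) , (b , b∈ , y→b))) with total (∈∉⇒≢ b∈ u∉)
      ... | inj₂ u→b = b , b∈ , u→b
      ... | inj₁ b→u with _ , _ , y→a ← uniform b∈ a∈ u∉ y∉ (b→u , u→y , y→b) =
        contradiction y→a (asym a→y)

-- Comparison of strong modules.

-- The form in which strength is applied: `x` makes the two modules comparable and `y` excludes one
-- of the two inclusions.
absorbs : ∀ {IsModule : Pred (Subset n) 0ℓ} {M N x y} → Strong IsModule M → IsModule N →
          x ∈ M → x ∈ N → y ∈ M → y ∉ N → N ⊆ M
absorbs {N = N} {x} (_ , comparable) N-mod x∈M x∈N y∈M y∉N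
  with comparable N N-mod (x , x∈p∩q⁺ (x∈M , x∈N))
... | inj₁ M⊆N = contradiction (M⊆N y∈M) y∉N
... | inj₂ N⊆M = N⊆M

module _ (T : Tournament (Fin n)) where
  open Cycles T

  strong-C₃⇒strong : ∀ {M} → Strong (HypergraphModule (C₃ T)) M →
                     Strong (TournamentModule T) M
  strong-C₃⇒strong {M} strong@(mod , comparable) =
    isModule , λ N → comparable N ∘ tournamentModule⇒hypergraphModule
    where
    open Splitting T (hypergraphModule⇒cycleModule mod)

    isModule : TournamentModule T M
    isModule x y v x∈ y∈ x→v v→y with v ∈? M
    ... | yes v∈ = v∈
    -- The module `low v` would be contained in `M`, but it contains `v`.
    ... | no v∉ = absorbs strong (tournamentModule⇒hypergraphModule (low-module v∉ y∈ v→y))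
      x∈ (in-neighbour∈low x∈ x→v) y∈ (out-neighbour∉low y∈ v→y) (v∈low x∈ v∉ x→v)

  strong⇒strong-C₃ : ∀ {M} → Strong (TournamentModule T) M →
                     Strong (HypergraphModule (C₃ T)) M
  strong⇒strong-C₃ {M} strong@(mod , _) = tournamentModule⇒hypergraphModule mod , compare
    where
    compare : ∀ N → HypergraphModule (C₃ T) N → Nonempty (M ∩ N) → M ⊆ N ⊎ N ⊆ M
    compare N N-mod (x , x∈) with any? (λ v → (v ∈? M) ×-dec ¬? (v ∈? N))
    ... | no none = inj₁ λ {v} v∈M → inside-N v v∈M
      where
      inside-N : ∀ v → v ∈ M → v ∈ N
      inside-N v v∈M with v ∈? N
      ... | yes v∈N = v∈N
      ... | no v∉N  = contradiction (v , v∈M , v∉N) none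
    ... | yes (v , v∈M , v∉N) = inj₂ N⊆M
      where
      cm = hypergraphModule⇒cycleModule N-mod
      module Up   = Splitting T cm
      -- Under reversal, `Down.low v` collects the out-neighbours of `v` in `N`.
      module Down = Splitting (reverse T) (reverse-cycleModule cm)

      x∈M : x ∈ M
      x∈M = proj₁ (x∈p∩q⁻ M N x∈)

      x∈N : x ∈ N
      x∈N = proj₂ (x∈p∩q⁻ M N x∈)

      N⊆M : N ⊆ M
      N⊆M with Up.splits? v
      -- The hull contains `N` but misses `v`, so `M` absorbs it.
      ... | no unsplit = λ u∈N →
        absorbs strong Up.hull-module x∈M (∈⟦⟧⁺ Up.hull? (inj₁ x∈N)) v∈M
          ([ v∉N , unsplit ∘ proj₂ ]′ ∘ ∈⟦⟧⁻ Up.hull?) (∈⟦⟧⁺ Up.hull? (inj₁ u∈N))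
      -- `Up.low v` and `Down.low v` together cover `N`, so it suffices that `M` absorbs both.
      ... | yes ((a , a∈ , a→v) , (b , b∈ , v→b)) = λ u∈N →
        [ (λ u→v → proj₁ both (Up.in-neighbour∈low u∈N u→v))
        , (λ v→u → proj₂ both (Down.in-neighbour∈low u∈N v→u)) ]′ (total (∈∉⇒≢ u∈N v∉N))
        where
        up⊆M : ∀ {y} → y ∈ M → y ∈ N → Arc v y → Up.low v ⊆ M
        up⊆M y∈M y∈N v→y = absorbs strong (Up.low-module v∉N y∈N v→y)
          v∈M (Up.v∈low a∈ v∉N a→v) y∈M (Up.out-neighbour∉low y∈N v→y)

        down⊆M : ∀ {y} → y ∈ M → y ∈ N → Arc y v → Down.low v ⊆ M
        down⊆M y∈M y∈N y→v =
          absorbs strong (reverse-module T (Down.low-module v∉N y∈N y→v))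
            v∈M (Down.v∈low b∈ v∉N v→b) y∈M (Down.out-neighbour∉low y∈N y→v)

        both : Up.low v ⊆ M × Down.low v ⊆ M
        -- Each absorption needs a vertex of both `M` and `N` on the opposite side of `v`. On one
        -- side this is `x`; the set absorbed first puts `b` or `a` into `M` for the other.
        both with total (∈∉⇒≢ x∈N v∉N)
        ... | inj₁ x→v =
          up⊆M (down⊆M x∈M x∈N x→v (Down.in-neighbour∈low b∈ v→b)) b∈ v→b ,
          down⊆M x∈M x∈N x→v
        ... | inj₂ v→x =
          up⊆M x∈M x∈N v→x ,
          down⊆M (up⊆M x∈M x∈N v→x (Up.in-neighbour∈low a∈ a→v)) a∈ a→v

-- Transfer between hypergraphs with equal edge sets.

≐-module : ∀ {H K : Hypergraph₃ n} → H ≐ K → ∀ {M} → HypergraphModule H M → HypergraphModule K M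
≐-module H≐K mod e edge meets leaves
  with m , m∈ , e∩M≡m , exchange ← mod e (Equivalence.from (H≐K e) edge) meets leaves =
  m , m∈ , e∩M≡m , λ x x∈ → Equivalence.to (H≐K _) (exchange x x∈)

≐-strong : ∀ {H K : Hypergraph₃ n} → H ≐ K → ∀ {M} →
           Strong (HypergraphModule H) M → Strong (HypergraphModule K) M
≐-strong {H = H} {K} H≐K (mod , comparable) =
  ≐-module {H = H} {K} H≐K mod ,
  λ N → comparable N ∘ ≐-module {H = K} {H} (⇔-sym ∘ H≐K)

theorem10 : ∀ (n : ℕ) (H : Hypergraph₃ n) → Realizable H →
    ∀ (T : Tournament (Fin n)) → T Realizes H →
    ∀ (M : Subset n) →
    Strong (HypergraphModule H) M ⇔ Strong (TournamentModule T) M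
theorem10 n H _ T T-realizes M = mk⇔
  (strong-C₃⇒strong T ∘ ≐-strong {H = H} {C₃ T} T-realizes)
  (≐-strong {H = C₃ T} {H} (⇔-sym ∘ T-realizes) ∘ strong⇒strong-C₃ T)
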